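{- Let $k\ge 1$ and let $w$ be an infinite word over the ordered alphabet $A=\{0,1,\ldots,k\}$, $0<1<\cdots<k$, such that every letter of $A$ occurs in $w$. The following statements are equivalent: (1) $w$ is Sturmian over the alphabet $\{0,1\}$. (2) $w$ satisfies the Nice Factors Ordering property (NFOp).
   Context: A factor of $w$ is a finite word occurring as a block of consecutive letters of $w$; $\mathrm{Fact}(w)$ is the set of factors; $A^*$ is the set of finite words over $A$, including the empty word. For finite words, $v<_{\mathrm{lex}}v'$ means $|v|=|v'|$ and there are a word $\lambda$ and letters $a<b$ such that $\lambda a$ is a prefix of $v$ and $\lambda b$ is a prefix of $v'$. For $v,v'\in\mathrm{Fact}(w)$, $v'=\mathrm{succ}_w(v)$ means $v<_{\mathrm{lex}}v'$ and there is no $f\in\mathrm{Fact}(w)$ with $v<_{\mathrm{lex}}f<_{\mathrm{lex}}v'$. NFOp: $w$ (whose set of occurring letters is exactly $A=\{0,\dots,k\}$, $k\ge1$) has the NFOp if one of the following equivalent conditions holds: (i) for every $v,v'\in\mathrm{Fact}(w)$ with $v'=\mathrm{succ}_w(v)$ there exist letters $a<b$ in $A$ and $\lambda,\mu\in A^*$ such that either $v=\lambda ab\mu$ and $v'=\lambda ba\mu$, or $v=\lambda a$ and $v'=\lambda b$; (ii) for every $v,v'\in\mathrm{Fact}(w)$ with $v'=\mathrm{succ}_w(v)$ there exist $m\in A$ and $\lambda,\mu\in A^*$ such that either $v=\lambda m(m+1)\mu$ and $v'=\lambda (m+1)m\mu$, or $v=\lambda m$ and $v'=\lambda(m+1)$;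 (iii) $A=\{0,1\}$ and for every $v,v'\in\mathrm{Fact}(w)$ with $v'=\mathrm{succ}_w(v)$ there exist $\lambda,\mu\in A^*$ such that either $v=\lambda 01\mu$ and $v'=\lambda 10\mu$, or $v=\lambda 0$ and $v'=\lambda 1$. Sturmian: an infinite word over $\{0,1\}$ is Sturmian if it is aperiodic (not ultimately periodic) and balanced (for any two factors $u,u'$ of equal length and each letter $x$, the numbers of occurrences of $x$ in $u$ and in $u'$ differ by at most $1$); equivalently, it has exactly $n+1$ factors of length $n$ for every $n\ge 0$. -}

module Defs where

open import Data.Nat.Base using (ℕ; suc; _+_; _≤_; ∣_-_∣)
open import Data.Fin.Base as Fin using (Fin; toℕ)
open import Data.Fin.Properties using (_≟_)
open import Data.List.Base using (List; []; _∷_; [_]; _++_; length; filter; applyUpTo)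
open import Data.List.Relation.Binary.Prefix.Heterogeneous using (Prefix)
open import Data.Product.Base using (∃; ∃₂; ∃-syntax; _×_)
open import Data.Sum.Base using (_⊎_)
open import Relation.Binary.PropositionalEquality.Core using (_≡_)
open import Relation.Nullary.Negation.Core using (¬_)

-- Letter k is the ordered alphabet {0 < 1 < ⋯ < k}.
Letter : ℕ → Set
Letter k = Fin (suc k)

Word : ℕ → Set
Word k = List (Letter k)

InfWord : ℕ → Set
InfWord k = ℕ → Letter k

module _ {k : ℕ} where

  EveryLetterOccurs : InfWord k → Set
  EveryLetterOccurs w = ∀ a → ∃[ n ] w n ≡ a

  Factor : InfWord k → Word k → Set
  Factor w v = ∃₂ λ i n → v ≡ applyUpTo (λ j → w (i + j)) n

  infix 4 _<lex_

  _<lex_ : Word k → Word k → Set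
  v <lex v′ =
    length v ≡ length v′ ×
    (∃[ l ] ∃[ a ] ∃[ b ]
      a Fin.< b × Prefix _≡_ (l ++ [ a ]) v × Prefix _≡_ (l ++ [ b ]) v′)

  -- IsSucc w v v′ means v′ = succ_w(v), for factors v and v′ of w.
  IsSucc : InfWord k → Word k → Word k → Set
  IsSucc w v v′ =
    Factor w v × Factor w v′ × v <lex v′ ×
    ¬ (∃[ f ] Factor w f × v <lex f × f <lex v′)

  -- Either v = λabμ and v′ = λbaμ, or v = λa and v′ = λb.
  NiceStep : Letter k → Letter k → Word k → Word k → Set
  NiceStep a b v v′ =
    (∃[ l ] ∃[ m ] v ≡ l ++ a ∷ b ∷ m × v′ ≡ l ++ b ∷ a ∷ m) ⊎
    (∃[ l ] v ≡ l ++ [ a ] × v′ ≡ l ++ [ b ])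

  -- The Nice Factors Ordering property is given by three conditions that are
  -- asserted to be equivalent for words in which every letter occurs; any of
  -- them may serve as its definition.

  NFOp₁ : InfWord k → Set
  NFOp₁ w = ∀ v v′ → IsSucc w v v′ →
    ∃[ a ] ∃[ b ] a Fin.< b × NiceStep a b v v′

  NFOp₂ : InfWord k → Set
  NFOp₂ w = ∀ v v′ → IsSucc w v v′ →
    ∃[ m ] ∃[ m+1 ] toℕ m+1 ≡ suc (toℕ m) × NiceStep m m+1 v v′

  -- k ≡ 1 says that the alphabet is {0,1}.
  NFOp₃ : InfWord k → Set
  NFOp₃ w = k ≡ 1 × (∀ v v′ → IsSucc w v v′ →
    ∃[ a ] ∃[ b ] toℕ a ≡ 0 × toℕ b ≡ 1 × NiceStep a b v v′)

  UltimatelyPeriodic : InfWord k → Set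
  UltimatelyPeriodic w =
    ∃[ N ] ∃[ p ] 1 ≤ p × (∀ n → N ≤ n → w (n + p) ≡ w n)

  occurrences : Letter k → Word k → ℕ
  occurrences x u = length (filter (x ≟_) u)

  Balanced : InfWord k → Set
  Balanced w = ∀ u u′ → Factor w u → Factor w u′ → length u ≡ length u′ →
    ∀ x → ∣ occurrences x u - occurrences x u′ ∣ ≤ 1

  -- Sturmian over {0,1}: the first component says that w is a word over {0,1}.
  Sturmian : InfWord k → Set
  Sturmian w = (∀ n → toℕ (w n) ≤ 1) × ¬ UltimatelyPeriodic w × Balanced w

{-# OPTIONS --safe #-}
module Submission where

-- Every conclusion is stable under double negation, so the classical arguments below
-- are constructively valid.
--
-- Sturmian ⇒ NFOp.  Let the height of a factor be the sum of the weights of its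
-- prefixes.  Balance makes the height strictly increasing in the lexicographic order
-- and confines it to n + 1 values at length n; aperiodicity provides n + 1 factors.
-- So consecutive factors have consecutive heights: exactly one prefix weight changes.
--
-- NFOp ⇒ Sturmian.  The greatest factor starting with z and the least one starting with
-- z + 1 are z(z+1)c and (z+1)zc.  With three letters, this turns a factor 0 1^i 2 into a
-- shorter one, and 2 1^i 0 likewise, which is absurd; so the word is binary.  Weights
-- never decrease along the chain of factors, and stay constant on long factors of an
-- ultimately periodic word, which would then be constant; so the word is aperiodic.
-- Finally all factors lie between 0c and 1c, whose weights differ by one.

open import Defs
open import Data.Empty using (⊥; ⊥-elim)
open import Data.Fin.Base using (Fin; fromℕ<; punchOut; toℕ)
import Data.Fin.Base as Fin
import Data.Fin.Properties as Fin
open import Data.List.Base using ([]; _∷_; [_]; _++_; length; applyUpTo)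
open import Data.List.Properties using (∷-injectiveˡ; ∷-injectiveʳ)
open import Data.List.Relation.Binary.Prefix.Heterogeneous using (Prefix; []; _∷_)
open import Data.Nat.DivMod using (_%_; _/_; m%n<n; m≡m%n+[m/n]*n)
open import Data.Nat.Tactic.RingSolver using (solve-∀)
open import Data.Nat.Base hiding (_%_; _/_)
open import Data.Nat.Properties
open import Data.Product.Base using (∃₂; ∃-syntax; Σ-syntax; _×_; _,_; proj₁; proj₂)
open import Data.Sum.Base using (_⊎_; inj₁; inj₂)
open import Function.Bundles using (_⇔_; mk⇔)
open import Relation.Binary.Definitions using (tri<; tri≈; tri>)
open import Relation.Binary.PropositionalEquality hiding ([_])
open import Relation.Nullary using (¬_; Dec; yes; no)
open import Relation.Nullary.Decidable using (decidable-stable; map′; _×-dec_)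

-- Factors as windows: order, nice steps and weights.

-- A factor is given by a length n and a starting position i; Less, Agree, Succ and
-- Nice compare the factors of length n at positions i and j.
module Seq (x : ℕ → ℕ) where

  private variable n m i j l d r : ℕ

  data Agree : ℕ → ℕ → ℕ → Set where
    []  : Agree 0 i j
    _∷_ : x i ≡ x j → Agree n (suc i) (suc j) → Agree (suc n) i j

  data Less : ℕ → ℕ → ℕ → Set where
    here  : x i < x j → Less (suc n) i j
    there : x i ≡ x j → Less n (suc i) (suc j) → Less (suc n) i j

  Succ : ℕ → ℕ → ℕ → Set
  Succ n i j = Less n i j × (∀ f → Less n i f → ¬ Less n f j)

  data Nice : ℕ → ℕ → ℕ → Set where
    last : x i < x j → Nice 1 i j
    swap : x i < x j → x (suc i) ≡ x j → x (suc j) ≡ x i →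
           Agree n (2 + i) (2 + j) → Nice (2 + n) i j
    skip : x i ≡ x j → Nice n (suc i) (suc j) → Nice (suc n) i j

  wt : ℕ → ℕ → ℕ
  wt zero    i = 0
  wt (suc n) i = x i + wt n (suc i)

  Periodic : Set
  Periodic = ∃[ N ] ∃[ p ] 1 ≤ p × (∀ n → N ≤ n → x (n + p) ≡ x n)

  agree-sym : Agree n i j → Agree n j i
  agree-sym []       = []
  agree-sym (e ∷ es) = sym e ∷ agree-sym es

  agree-trans : Agree n i j → Agree n j l → Agree n i l
  agree-trans []       []       = []
  agree-trans (e ∷ es) (f ∷ fs) = trans e f ∷ agree-trans es fs

  agree-take : m ≤ n → Agree n i j → Agree m i j
  agree-take z≤n     _        = []
  agree-take (s≤s h) (e ∷ es) = e ∷ agree-take h es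

  agree-init : Agree (suc n) i j → Agree n i j
  agree-init = agree-take (n≤1+n _)

  agree-at : Agree n i j → m < n → x (m + i) ≡ x (m + j)
  agree-at {m = zero}  (e ∷ es) _       = e
  agree-at {i = i} {j} {suc m} (e ∷ es) (s≤s h) =
    subst₂ (λ a b → x a ≡ x b) (+-suc m i) (+-suc m j) (agree-at es h)

  at-agree : ∀ n {i j} → (∀ m → m < n → x (m + i) ≡ x (m + j)) → Agree n i j
  at-agree zero    h = []
  at-agree (suc n) {i} {j} h = h 0 z<s ∷ at-agree n λ m m<n →
    subst₂ (λ a b → x a ≡ x b) (sym (+-suc m i)) (sym (+-suc m j)) (h (suc m) (s<s m<n))

  agree-snoc : Agree n i j → x (n + i) ≡ x (n + j) → Agree (suc n) i j
  agree-snoc []       e = e ∷ []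
  agree-snoc {suc n} {i} {j} (f ∷ fs) e = f ∷ agree-snoc fs
    (subst₂ (λ a b → x a ≡ x b) (sym (+-suc n i)) (sym (+-suc n j)) e)

  agree? : ∀ n i j → Dec (Agree n i j)
  agree? zero    i j = yes []
  agree? (suc n) i j = map′ (λ (e , es) → e ∷ es) (λ { (e ∷ es) → e , es })
    ((x i ≟ x j) ×-dec agree? n (suc i) (suc j))

  less-irrefl : ¬ Less n i i
  less-irrefl (here h)    = <-irrefl refl h
  less-irrefl (there _ l) = less-irrefl l

  less-trans : Less n i j → Less n j l → Less n i l
  less-trans (here h)    (here g)    = here (<-trans h g)
  less-trans {n = suc _} {i} (here h) (there e _) = here (subst (x i <_) e h)
  less-trans {l = l} (there e _) (here g) = here (subst (_< x l) (sym e) g)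
  less-trans (there e h) (there f g) = there (trans e f) (less-trans h g)

  less-agree : Less n i j → Agree n j l → Less n i l
  less-agree {i = i} (here h) (e ∷ _)  = here (subst (x i <_) e h)
  less-agree (there f h) (e ∷ es) = there (trans f e) (less-agree h es)

  agree-less : Agree n i j → Less n j l → Less n i l
  agree-less {l = l} (e ∷ _) (here h) = here (subst (_< x l) (sym e) h)
  agree-less (e ∷ es) (there f h) = there (trans e f) (agree-less es h)

  less-extend : m ≤ n → Less m i j → Less n i j
  less-extend (s≤s h) (here l)    = here l
  less-extend (s≤s h) (there e l) = there e (less-extend h l)

  compare′ : ∀ n i j → Less n i j ⊎ Agree n i j ⊎ Less n j i
  compare′ zero    i j = inj₂ (inj₁ [])
  compare′ (suc n) i j with <-cmp (x i) (x j)
  ... | tri< h _ _ = inj₁ (here h)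
  ... | tri> _ _ h = inj₂ (inj₂ (here h))
  ... | tri≈ _ e _ with compare′ n (suc i) (suc j)
  ...   | inj₁ l        = inj₁ (there e l)
  ...   | inj₂ (inj₁ a) = inj₂ (inj₁ (e ∷ a))
  ...   | inj₂ (inj₂ l) = inj₂ (inj₂ (there (sym e) l))

  ≮-<-trans : ¬ Less n j i → Less n j l → Less n i l
  ≮-<-trans {n} {j} {i} ¬ji jl with compare′ n i j
  ... | inj₁ ij        = less-trans ij jl
  ... | inj₂ (inj₁ ij) = agree-less ij jl
  ... | inj₂ (inj₂ ji) = ⊥-elim (¬ji ji)

  ≮-trans : ¬ Less n i j → ¬ Less n j l → ¬ Less n i l
  ≮-trans ¬ij ¬jl il = ¬jl (≮-<-trans ¬ij il)

  less-diff : Less n i j → ∃[ d ] d < n × Agree d i j × x (d + i) < x (d + j)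
  less-diff (here h) = 0 , z<s , [] , h
  less-diff {i = i} {j} (there e l) with d , d<n , a , h ← less-diff l =
    suc d , s<s d<n , e ∷ a , subst₂ (λ a b → x a < x b) (+-suc d i) (+-suc d j) h

  wt-snoc : ∀ n i → wt (suc n) i ≡ wt n i + x (n + i)
  wt-snoc zero    i = +-comm (x i) 0
  wt-snoc (suc n) i = begin
    x i + wt (suc n) (suc i)         ≡⟨ cong (x i +_) (wt-snoc n (suc i)) ⟩
    x i + (wt n (suc i) + x (n + suc i)) ≡⟨ sym (+-assoc (x i) _ _) ⟩
    wt (suc n) i + x (n + suc i)     ≡⟨ cong (λ a → wt (suc n) i + x a) (+-suc n i) ⟩
    wt (suc n) i + x (suc n + i)     ∎
    where open ≡-Reasoning

  wt-agree : Agree n i j → wt n i ≡ wt n j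
  wt-agree []       = refl
  wt-agree (e ∷ es) = cong₂ _+_ e (wt-agree es)

  -- A swap keeps the weight. Only a change of the last letter raises it, and then the factors agree
  -- up to that letter.
  nice-wt : Nice n i j → wt n i ≡ wt n j ⊎
    (wt n i < wt n j × ∃[ m ] n ≡ suc m × Agree m i j × x (m + i) < x (m + j))
  nice-wt (last h) = inj₂ (+-monoˡ-< 0 h , 0 , refl , [] , h)
  nice-wt {i = i} {j} (swap {n = n} h e f a) = inj₁ (begin
    x i + (x (suc i) + wt n (2 + i)) ≡⟨ cong₂ (λ u v → x i + (u + v)) e (wt-agree a) ⟩
    x i + (x j + wt n (2 + j))       ≡⟨ sym (+-assoc (x i) (x j) _) ⟩
    x i + x j + wt n (2 + j)         ≡⟨ cong (_+ wt n (2 + j)) (+-comm (x i) (x j)) ⟩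
    x j + x i + wt n (2 + j)         ≡⟨ +-assoc (x j) (x i) _ ⟩
    x j + (x i + wt n (2 + j))       ≡⟨ cong (λ u → x j + (u + wt n (2 + j))) (sym f) ⟩
    x j + (x (suc j) + wt n (2 + j)) ∎)
    where open ≡-Reasoning
  nice-wt {i = i} {j} (skip {n = n} e s) with nice-wt s
  ... | inj₁ q = inj₁ (cong₂ _+_ e q)
  ... | inj₂ (q , m , refl , a , h) = inj₂
    ( subst (λ u → x i + wt n (suc i) < u + wt n (suc j)) e (+-monoʳ-< (x i) q)
    , suc m , refl , e ∷ a , subst₂ (λ a b → x a < x b) (+-suc m i) (+-suc m j) h)

  nice-diff : Nice n i j → ∃[ d ] Agree d i j × x (d + i) < x (d + j) ×
    (suc d ≡ n ⊎ ∃[ r ] n ≡ suc (suc d) + r × x (suc d + i) ≡ x (d + j) ×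
      x (suc d + j) ≡ x (d + i) × Agree r (2 + d + i) (2 + d + j))
  nice-diff (last h) = 0 , [] , h , inj₁ refl
  nice-diff (swap h e f a) = 0 , [] , h , inj₂ (_ , refl , e , f , a)
  nice-diff {i = i} {j} (skip e s) with nice-diff s
  ... | d , a , h , inj₁ refl rewrite +-suc d i | +-suc d j =
    suc d , e ∷ a , h , inj₁ refl
  ... | d , a , h , inj₂ (r , refl , f , g , b) rewrite +-suc d i | +-suc d j =
    suc d , e ∷ a , h , inj₂ (r , refl , f , g , b)

  -- The chain of factors when letters are bounded.

  module Bounded (B : ℕ) (x<B : ∀ i → x i < B) where

    -- The factor read as a numeral in base `B`. At a fixed length its size follows the
    -- lexicographic order; it bounds the search in `crossing` and feeds the pigeonhole in
    -- `special`.
    val : ℕ → ℕ → ℕ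
    val zero    i = 0
    val (suc n) i = x i * B ^ n + val n (suc i)

    val<B^n : ∀ n i → val n i < B ^ n
    val<B^n zero    i = z<s
    val<B^n (suc n) i = begin-strict
      x i * B ^ n + val n (suc i) <⟨ +-monoʳ-< (x i * B ^ n) (val<B^n n (suc i)) ⟩
      x i * B ^ n + B ^ n         ≡⟨ +-comm (x i * B ^ n) _ ⟩
      suc (x i) * B ^ n           ≤⟨ *-monoˡ-≤ (B ^ n) (x<B i) ⟩
      B * B ^ n                   ∎
      where open ≤-Reasoning

    val-mono : Less n i j → val n i < val n j
    val-mono {suc n} {i} {j} (here h) = begin-strict
      x i * B ^ n + val n (suc i) <⟨ +-monoʳ-< (x i * B ^ n) (val<B^n n (suc i)) ⟩
      x i * B ^ n + B ^ n         ≡⟨ +-comm (x i * B ^ n) _ ⟩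
      suc (x i) * B ^ n           ≤⟨ *-monoˡ-≤ (B ^ n) h ⟩
      x j * B ^ n                 ≤⟨ m≤m+n _ _ ⟩
      x j * B ^ n + val n (suc j) ∎
      where open ≤-Reasoning
    val-mono {suc n} {i} {j} (there e l) =
      subst (λ u → x i * B ^ n + val n (suc i) < u * B ^ n + val n (suc j)) e
        (+-monoʳ-< (x i * B ^ n) (val-mono l))

    val-injective : ∀ n {i j} → val n i ≡ val n j → Agree n i j
    val-injective n {i} {j} e with compare′ n i j
    ... | inj₁ l        = ⊥-elim (<-irrefl e (val-mono l))
    ... | inj₂ (inj₁ a) = a
    ... | inj₂ (inj₂ l) = ⊥-elim (<-irrefl (sym e) (val-mono l))

    -- A discrete intermediate value principle. A factor `f` strictly between `i` and `j` replaces
    -- `i` if `P f` holds and `j` otherwise; `fuel` bounds the difference of values. Whether such an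
    -- `f` exists is not decided, hence the double negation.
    crossing : {P : ℕ → Set} → (∀ f → Dec (P f)) → Less n i j → P i → ¬ P j →
      ¬ ¬ (∃₂ λ p q → Succ n p q × P p × ¬ P q)
    crossing {n} {i} {j} {P} P? l Pi ¬Pj = go (val n j) l Pi ¬Pj (m≤n+m _ _)
      where
      go : ∀ fuel {i j} → Less n i j → P i → ¬ P j → val n j ≤ val n i + fuel →
        ¬ ¬ (∃₂ λ p q → Succ n p q × P p × ¬ P q)
      go zero {i} ij Pi ¬Pj h k =
        <⇒≱ (val-mono ij) (subst (_ ≤_) (+-identityʳ (val n i)) h)
      go (suc fuel) {i} {j} ij Pi ¬Pj h k = k (i , j , (ij , between) , Pi , ¬Pj)
        where
        h′ : val n j ≤ suc (val n i) + fuel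
        h′ = subst (val n j ≤_) (+-suc (val n i) fuel) h
        between : ∀ f → Less n i f → ¬ Less n f j
        between f if fj with P? f
        ... | yes Pf = go fuel fj Pf ¬Pj (≤-trans h′ (+-monoˡ-≤ fuel (val-mono if))) k
        ... | no ¬Pf = go fuel if Pi ¬Pf (s≤s⁻¹ (≤-trans (val-mono fj) h′)) k

    module _ (nice : ∀ {n i j} → Succ n i j → Nice n i j) where

      -- By `nice-wt` no step between consecutive factors lowers the weight, whereas a drop from `i`
      -- to `j` would make `crossing` find such a step.
      wt-mono : Less n i j → wt n i ≤ wt n j
      wt-mono {n} {i} {j} l = decidable-stable (wt n i ≤? wt n j) λ ¬h →
        crossing (λ f → wt n i ≤? wt n f) l ≤-refl ¬h λ (p , q , s , hp , ¬hq) →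
          ¬hq (≤-trans hp (step (nice-wt (nice s))))
        where
        step : ∀ {a b} {P : Set} → a ≡ b ⊎ (a < b × P) → a ≤ b
        step (inj₁ e)       = ≤-reflexive e
        step (inj₂ (h , _)) = <⇒≤ h

      ≮⇒wt≤ : ¬ Less n i j → wt n j ≤ wt n i
      ≮⇒wt≤ {n} {i} {j} h with compare′ n i j
      ... | inj₁ l        = ⊥-elim (h l)
      ... | inj₂ (inj₁ a) = ≤-reflexive (sym (wt-agree a))
      ... | inj₂ (inj₂ l) = wt-mono l

      -- Far out, the factor determines the next letter, so that a step between
      -- consecutive factors never changes the last letter and keeps the weight.
      periodic⇒constant : Periodic → ∀ i → x i ≡ x (suc i)
      periodic⇒constant (N , p , 1≤p , per) i = begin
        -- Sliding a window by one place trades its first letter for the next one at equal weight.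
        -- From `i` with length `M + 2` and from `i + 1` with length `M + 1`, the letter gained is
        -- the same.
        x i                   ≡⟨ return (suc M) (n≤1+n M) i ⟩
        x (suc (M + suc i))   ≡⟨ cong x (sym (+-suc M (suc i))) ⟩
        x (M + suc (suc i))   ≡⟨ sym (return M ≤-refl (suc i)) ⟩
        x (suc i)             ∎
        where
        open ≡-Reasoning
        -- At length at least `N + p`, the letter after a factor repeats the one `p` places earlier,
        -- which lies inside the factor and at a position not before `N`.
        M : ℕ
        M = N + p

        determined : ∀ n → M ≤ n → ∀ {i j} → Agree n i j → x (n + i) ≡ x (n + j)
        determined n M≤n {i} {j} a = begin
          x (n + i) ≡⟨ back i ⟩
          x (k + i) ≡⟨ agree-at a (subst (k <_) k+p≡n (m<m+n k 1≤p)) ⟩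
          x (k + j) ≡⟨ sym (back j) ⟩
          x (n + j) ∎
          where
          k : ℕ
          k = n ∸ p
          k+p≡n : k + p ≡ n
          k+p≡n = m∸n+n≡m (≤-trans (m≤n+m p N) M≤n)
          N≤k : N ≤ k
          N≤k = subst (_≤ k) (m+n∸n≡m N p) (∸-monoˡ-≤ p M≤n)
          back : ∀ i → x (n + i) ≡ x (k + i)
          back i = begin
            x (n + i)       ≡⟨ cong (λ u → x (u + i)) (sym k+p≡n) ⟩
            x (k + p + i)   ≡⟨ cong x (+-assoc k p i) ⟩
            x (k + (p + i)) ≡⟨ cong (λ u → x (k + u)) (+-comm p i) ⟩
            x (k + (i + p)) ≡⟨ cong x (sym (+-assoc k i p)) ⟩
            x (k + i + p)   ≡⟨ per (k + i) (≤-trans N≤k (m≤m+n k i)) ⟩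
            x (k + i)       ∎

        less-equal : ∀ n → M ≤ n → ∀ {i j} → Less (suc n) i j → wt (suc n) i ≡ wt (suc n) j
        less-equal n M≤n {i} {j} l = decidable-stable (wt (suc n) i ≟ wt (suc n) j) λ ¬e →
          crossing (λ f → wt (suc n) i ≟ wt (suc n) f) l refl ¬e λ (p , q , s , hp , ¬hq) →
            ¬hq (trans hp (step (nice-wt (nice s))))
          where
          step : ∀ {p q} → wt (suc n) p ≡ wt (suc n) q ⊎ (wt (suc n) p < wt (suc n) q ×
            ∃[ m ] suc n ≡ suc m × Agree m p q × x (m + p) < x (m + q)) →
            wt (suc n) p ≡ wt (suc n) q
          step (inj₁ e) = e
          step (inj₂ (_ , _ , refl , a , h)) = ⊥-elim (<-irrefl (determined n M≤n a) h)

        wt-equal : ∀ n → M ≤ n → ∀ i j → wt (suc n) i ≡ wt (suc n) j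
        wt-equal n M≤n i j with compare′ (suc n) i j
        ... | inj₁ l        = less-equal n M≤n l
        ... | inj₂ (inj₁ a) = wt-agree a
        ... | inj₂ (inj₂ l) = sym (less-equal n M≤n l)

        return : ∀ n → M ≤ n → ∀ i → x i ≡ x (n + suc i)
        return n M≤n i = +-cancelʳ-≡ (wt n (suc i)) _ _ (begin
          x i + wt n (suc i)           ≡⟨ wt-equal n M≤n i (suc i) ⟩
          wt (suc n) (suc i)           ≡⟨ wt-snoc n (suc i) ⟩
          wt n (suc i) + x (n + suc i) ≡⟨ +-comm (wt n (suc i)) _ ⟩
          x (n + suc i) + wt n (suc i) ∎)

-- NFOp leaves only the letters 0 and 1.

module Ordered (x : ℕ → ℕ) (B : ℕ) (x<B : ∀ i → x i < B)
  (nice : ∀ {n i j} → Seq.Succ x n i j → Seq.Nice x n i j) where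

  open Seq x
  open Bounded B x<B

  private variable n i j : ℕ

  Occurs : ℕ → Set
  Occurs z = ∃[ i ] x i ≡ z

  -- The positions p and q carry consecutive factors z(z+1)c and (z+1)zc, |c| = n.
  record Cross (z n p q : ℕ) : Set where
    field
      succ  : Succ (2 + n) p q
      p₀    : x p ≡ z
      p₁    : x (1 + p) ≡ suc z
      q₀    : x q ≡ suc z
      q₁    : x (1 + q) ≡ z
      agree : Agree n (2 + p) (2 + q)

    -- Anything above `p` that starts with `z` would lie strictly between `p` and `q`; dually for
    -- `q≤`.
    ≤p : ∀ {f} → x f ≡ z → ¬ Less (2 + n) p f
    ≤p {f} e pf = proj₂ succ f pf (here (subst₂ _<_ (sym e) (sym q₀) (n<1+n z)))

    q≤ : ∀ {f} → x f ≡ suc z → ¬ Less (2 + n) f q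
    q≤ {f} e = proj₂ succ f (here (subst₂ _<_ (sym p₀) (sym e) (n<1+n z)))

  -- The step at which the first letter passes from at most `z` to more than `z` changes that
  -- letter, and the length is at least 2, so it is a swap. Other first letters are excluded because
  -- the given occurrences of `z` and `z + 1` would lie in between.
  cross : ∀ n z → Occurs z → Occurs (suc z) → ¬ ¬ (∃₂ λ p q → Cross z n p q)
  cross n z (i , refl) (j , e) k =
    crossing (λ f → x f ≤? z) (here (subst (z <_) (sym e) (n<1+n z))) ≤-refl
      (λ h → <⇒≱ (n<1+n z) (subst (_≤ z) e h))
      λ (p , q , s , p≤z , q≰z) → k (p , q , build s p≤z (≰⇒> q≰z))
    where
    build : ∀ {p q} → Succ (2 + n) p q → x p ≤ z → z < x q → Cross z n p q
    build {p} {q} s p≤z z<q with nice s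
    ... | skip f _ = ⊥-elim (<-irrefl f (≤-<-trans p≤z z<q))
    ... | swap _ f g a = record
      { succ = s ; p₀ = p₀ ; p₁ = trans f q₀ ; q₀ = q₀ ; q₁ = trans g p₀ ; agree = a }
      where
      p₀ : x p ≡ z
      p₀ = ≤-antisym p≤z (≮⇒≥ λ p<z → proj₂ s i (here p<z) (here z<q))
      q₀ : x q ≡ suc z
      q₀ = ≤-antisym
        (≮⇒≥ λ h → proj₂ s j (here (≤-<-trans p≤z (subst (z <_) (sym e) (n<1+n z))))
                              (here (subst (_< x q) (sym e) h)))
        z<q

  -- Up n i and Down n i: the first letter other than 1 among the n letters from i
  -- on exists and is at least 2, respectively 0.
  data Up : ℕ → ℕ → Set where
    here  : 2 ≤ x i → Up (suc n) i
    there : x i ≡ 1 → Up n (suc i) → Up (suc n) i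

  data Down : ℕ → ℕ → Set where
    here  : x i ≡ 0 → Down (suc n) i
    there : x i ≡ 1 → Down n (suc i) → Down (suc n) i

  up-mono : Up n i → ¬ Less n j i → Up n j
  up-mono (here h) ¬l = here (≤-trans h (≮⇒≥ λ g → ¬l (here g)))
  up-mono {i = i} {j} (there e u) ¬l with m≤n⇒m<n∨m≡n (≮⇒≥ λ g → ¬l (here g))
  ... | inj₁ h = here (subst (_< x j) e h)
  ... | inj₂ f = there (trans (sym f) e) (up-mono u λ l → ¬l (there (sym f) l))

  down-mono : Down n i → ¬ Less n i j → Down n j
  down-mono {i = i} {j} (here e) ¬l =
    here (n≤0⇒n≡0 (subst (x j ≤_) e (≮⇒≥ λ g → ¬l (here g))))
  down-mono {i = i} {j} (there e u) ¬l with m≤n⇒m<n∨m≡n (≮⇒≥ λ g → ¬l (here g))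
  ... | inj₁ h = here (n<1⇒n≡0 (subst (x j <_) e h))
  ... | inj₂ f = there (trans f e) (down-mono u λ l → ¬l (there (sym f) l))

  up-agree : Up n i → Agree n i j → Up n j
  up-agree u a = up-mono u λ l → less-irrefl (agree-less a l)

  down-agree : Down n i → Agree n i j → Down n j
  down-agree u a = down-mono u λ l → less-irrefl (less-agree l (agree-sym a))

  -- If 0 1^i z is a factor with z ≥ 2, then so is 0 1^j z′ with z′ ≥ 2 and j < i,
  -- because c in the consecutive pair 01c, 10c is at least 1^(i-1) z.
  ¬0-up : Occurs 1 → ∀ n f → x f ≡ 0 → ¬ Up n (suc f)
  ¬0-up occ₁ (suc n) f f₀ u = cross n 0 (f , f₀) occ₁ λ (p , q , c) → descend c
    where
    descend : ∀ {p q} → Cross 0 n p q → ⊥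
    descend {p} {q} c = go u λ l → ≤p f₀ (there (trans p₀ (sym f₀)) l)
      where
      open Cross c
      go : Up (suc n) (suc f) → ¬ Less (suc n) (suc p) (suc f) → ⊥
      go (here h) ¬l = ¬l (here (subst (_< x (suc f)) (sym p₁) h))
      go (there e u) ¬l = ¬0-up occ₁ n (suc q) q₁
        (up-agree (up-mono u λ l → ¬l (there (trans p₁ (sym e)) l)) agree)

  -- Dual to `¬0-up`. Suppose that y 1^i 0 occurs with y ≥ 2. It is at least y(y-1)c, the least
  -- factor starting with y, which forces y = 2, i ≥ 1 and c at most 1^(i-1) 0. Then (y-1)yc
  -- contains y followed by c, a shorter instance.
  ¬down-2 : (∀ i z → z ≤ x i → Occurs z) → ∀ n f → 2 ≤ x f → ¬ Down n (suc f)
  ¬down-2 occ (suc n) f 2≤f u with x f in f₀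
  ¬down-2 occ (suc n) f (s≤s (s≤s _)) u | suc (suc z) =
    cross n (suc z) (occ f (suc z) (subst (suc z ≤_) (sym f₀) (n≤1+n (suc z)))) (f , f₀)
      λ (p , q , c) → descend c
    where
    descend : ∀ {p q} → Cross (suc z) n p q → ⊥
    descend {p} {q} c = go u λ l → q≤ f₀ (there (trans f₀ (sym q₀)) l)
      where
      open Cross c
      go : Down (suc n) (suc f) → ¬ Less (suc n) (suc f) (suc q) → ⊥
      go (here h) ¬l = ¬l (here (subst₂ _<_ (sym h) (sym q₁) z<s))
      go (there e u) ¬l with m≤n⇒m<n∨m≡n (≮⇒≥ λ g → ¬l (here g))
      ... | inj₁ h = <⇒≱ (subst₂ _<_ q₁ e h) (s≤s z≤n)
      ... | inj₂ g = ¬down-2 occ n (suc p)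
        (subst (2 ≤_) (sym p₁) (s≤s (s≤s z≤n)))
        (down-agree (down-mono u λ l → ¬l (there (sym g) l)) (agree-sym agree))

  split : ∀ a → a ≡ 0 ⊎ a ≡ 1 ⊎ 2 ≤ a
  split 0             = inj₁ refl
  split 1             = inj₂ (inj₁ refl)
  split (suc (suc a)) = inj₂ (inj₂ (s≤s (s≤s z≤n)))

  -- Going left from a letter that is at least 2, ones and large letters preserve `Up`, and a 0
  -- yields the configuration excluded by `¬0-up`.
  last-0 : ∀ n f → 2 ≤ x (n + f) →
    Up (suc n) f ⊎ ∃₂ λ m g → x g ≡ 0 × Up m (suc g)
  last-0 zero    f h = inj₁ (here h)
  last-0 (suc n) f h with last-0 n (suc f) (subst (λ u → 2 ≤ x u) (sym (+-suc n f)) h)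
  ... | inj₂ r = inj₂ r
  ... | inj₁ u with split (x f)
  ...   | inj₁ e = inj₂ (_ , f , e , u)
  ...   | inj₂ (inj₁ e) = inj₁ (there e u)
  ...   | inj₂ (inj₂ g) = inj₁ (here g)

  last-2 : ∀ n f → x (n + f) ≡ 0 →
    Down (suc n) f ⊎ ∃₂ λ m g → 2 ≤ x g × Down m (suc g)
  last-2 zero    f h = inj₁ (here h)
  last-2 (suc n) f h with last-2 n (suc f) (trans (cong x (+-suc n f)) h)
  ... | inj₂ r = inj₂ r
  ... | inj₁ u with split (x f)
  ...   | inj₁ e = inj₁ (here e)
  ...   | inj₂ (inj₁ e) = inj₁ (there e u)
  ...   | inj₂ (inj₂ g) = inj₂ (_ , f , g , u)

  binary : (∀ i z → z ≤ x i → Occurs z) → ∀ i → x i ≤ 1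
  binary occ j = ≮⇒≥ λ 2≤j → contra 2≤j (occ j 0 z≤n) (occ j 1 (<⇒≤ 2≤j))
    where
    contra : 2 ≤ x j → Occurs 0 → Occurs 1 → ⊥
    contra 2≤j (i , i₀) occ₁ with ≤-total i j
    ... | inj₁ i≤j with last-0 (j ∸ i) i (subst (λ u → 2 ≤ x u) (sym (m∸n+n≡m i≤j)) 2≤j)
    ...   | inj₂ (m , g , g₀ , u) = ¬0-up occ₁ m g g₀ u
    ...   | inj₁ (here h)         = <⇒≱ h (subst (_≤ 1) (sym i₀) z≤n)
    ...   | inj₁ (there e _) with () ← trans (sym i₀) e
    contra 2≤j (i , i₀) occ₁ | inj₂ j≤i with last-2 (i ∸ j) j (trans (cong x (m∸n+n≡m j≤i)) i₀)
    ...   | inj₂ (m , g , g₂ , u) = ¬down-2 occ m g g₂ u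
    ...   | inj₁ (here h)         = <⇒≱ 2≤j (subst (_≤ 1) (sym h) z≤n)
    ...   | inj₁ (there e _)      = <⇒≱ 2≤j (≤-reflexive e)

-- No factor of a binary word with NFOp lies above 1c.

¬¬-maximum : {P : ℕ → Set} (b : ℕ) → (∀ i → P i → i ≤ b) → ∀ {i} → P i →
  ¬ ¬ (∃[ g ] P g × (∀ f → P f → f ≤ g))
¬¬-maximum {P} b bound {i} = go b (m≤n+m b i)
  where
  go : ∀ fuel {i} → b ≤ i + fuel → P i → ¬ ¬ (∃[ g ] P g × (∀ f → P f → f ≤ g))
  go zero {i} h Pi k = k (i , Pi , λ f Pf →
    ≤-trans (bound f Pf) (subst (b ≤_) (+-identityʳ i) h))
  go (suc fuel) {i} h Pi k = k (i , Pi , λ f Pf → ≮⇒≥ λ i<f →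
    go fuel (≤-trans (subst (b ≤_) (+-suc i fuel) h) (+-monoˡ-≤ fuel i<f)) Pf k)

module Extremal (x : ℕ → ℕ) (x≤1 : ∀ i → x i ≤ 1)
  (nice : ∀ {n i j} → Seq.Succ x n i j → Seq.Nice x n i j)
  (occ₀ : ∃[ i ] x i ≡ 0) (occ₁ : ∃[ i ] x i ≡ 1) (aperiodic : ¬ Seq.Periodic x) where

  open Seq x
  open Ordered x 2 (λ i → s≤s (x≤1 i)) nice
  open Cross

  private variable m n p q p′ q′ i j d : ℕ

  <⇒0,1 : ∀ {i j} → x i < x j → x i ≡ 0 × x j ≡ 1
  <⇒0,1 {i} {j} h with e ← ≤-antisym (x≤1 j) (≤-trans (s≤s z≤n) h) =
    n<1⇒n≡0 (subst (x i <_) e h) , e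

  -- A prefix of the greatest factor starting with 0 is itself greatest, so the words c for growing
  -- lengths extend one another.
  coherent : Cross 0 m p q → Cross 0 n p′ q′ → m ≤ n → Agree (2 + m) p p′
  coherent {m} {p} {p′ = p′} c c′ m≤n with compare′ (2 + m) p p′
  ... | inj₁ l        = ⊥-elim (≤p c (p₀ c′) l)
  ... | inj₂ (inj₁ a) = a
  ... | inj₂ (inj₂ l) = ⊥-elim (≤p c′ (p₀ c) (less-extend (s≤s (s≤s m≤n)) l))

  coherent₁ : Cross 0 m p q → Cross 0 n p′ q′ → m ≤ n → Agree (suc m) (suc p) (suc p′)
  coherent₁ c c′ h with _ ∷ a ← coherent c c′ h = a

  -- While the two factors agree, the 1 is handed on from letter to letter; at a first difference
  -- the factor at `i` therefore has 1, the greatest letter.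
  ≮-shift : ∀ n i → x i ≡ 1 → ¬ Less n i (suc i)
  ≮-shift (suc n) i e (here h)    = <⇒≱ (subst (_< x (suc i)) e h) (x≤1 (suc i))
  ≮-shift (suc n) i e (there f l) = ≮-shift n (suc i) (trans (sym f) e) l

  ≮-shifts : ∀ n i k → (∀ j → j < k + i → x j ≡ 1) → ¬ Less n i (k + i)
  ≮-shifts n i zero    _    = less-irrefl
  ≮-shifts n i (suc k) ones = ≮-trans (≮-shifts n i k λ j h → ones j (m<n⇒m<1+n h))
    (≮-shift n (k + i) (ones (k + i) ≤-refl))

  -- The factor at i lies above 1c, where 01c is the greatest factor starting with 0.
  Above : ℕ → ℕ → Set
  Above n i = ∃₂ λ p q → Cross 0 n p q × Less (suc n) (suc p) i

  above-extend : Above m i → Cross 0 n p q → m ≤ n → Less (suc n) (suc p) i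
  above-extend (_ , _ , c , l) c′ m≤n =
    less-extend (s≤s m≤n) (agree-less (agree-sym (coherent₁ c c′ m≤n)) l)

  -- A 0 in front of a factor above 1c would give a factor above 01c, the greatest one starting with
  -- 0. A 1 in front keeps it above, since c is at most 1c by `≮-shift`.
  above-back : Above n (suc i) → Cross 0 (suc n) p q → x i ≡ 1 × Less (2 + n) (suc p) i
  above-back {n} {i} {p} (p′ , _ , c , l) c′ = xi≡1 , there (trans (p₁ c′) (sym xi≡1))
    (≮-<-trans (≮-shift (suc n) (suc p) (p₁ c′))
      (agree-less (agree-sym (coherent₁ c c′ (n≤1+n n))) l))
    where
    xi≡1 : x i ≡ 1
    xi≡1 = ≤-antisym (x≤1 i) (n≢0⇒n>0 λ e → ≤p c e (there (trans (p₀ c) (sym e)) l))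

  above-ones : Above n i → ∀ j → j < i → x j ≡ 1
  above-ones {n} {suc i} v j j<1+i = decidable-stable (x j ≟ 1) λ ≢1 →
    cross (suc n) 0 occ₀ occ₁ λ (p , q , c) → ≢1 (step c (m≤n⇒m<n∨m≡n (s≤s⁻¹ j<1+i)))
    where
    step : Cross 0 (suc n) p q → j < i ⊎ j ≡ i → x j ≡ 1
    step c (inj₁ h)    = above-ones (_ , _ , c , proj₂ (above-back v c)) j h
    step c (inj₂ refl) = proj₁ (above-back v c)

  -- If some factor were above 1c, then the suffix of the word at the last such
  -- position g would be the successor of 1c; hence the two would be 1ν10c and 1ν01c,
  -- making c = ν01c and the word itself ultimately periodic.
  ¬above : ¬ Above n i
  ¬above {n} {i} v₀ = ¬¬-maximum {λ i → ∃[ n ] Above n i} (proj₁ occ₀)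
      -- All letters before an `Above` position are 1, so no such position passes an occurrence of
      -- 0.
      (λ f (m , v) → ≮⇒≥ λ h → 0≢1+n (trans (sym (proj₂ occ₀)) (above-ones v _ h)))
      (n , v₀) λ (g , (m , v) , max) → refute g m v max
    where
    refute : ∀ g m → Above m g → (∀ f → (∃[ n ] Above n f) → f ≤ g) → ⊥
    refute g m v@(p̂ , q̂ , ĉ , l̂) max with less-diff l̂
    ... | d , d<1+m , â , d< = aperiodic
      -- Past the prefix 1ν10 of length `2 + d`, the word at `g` continues as c = ν01c, whose period
      -- |ν01| is `suc d`.
      (2 + d + g , suc d , s≤s z≤n , λ n N≤n →
        subst (λ u → x (u + suc d) ≡ x u) (m∸n+n≡m N≤n) (recur (n ∸ (2 + d + g))))
      where
      least : ∀ {n p q} → m ≤ n → Cross 0 n p q → Succ (suc n) (suc p) g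
      least {n} {p} m≤n c = above-extend v c m≤n , between
        where
        between : ∀ f → Less (suc n) (suc p) f → ¬ Less (suc n) f g
        -- Only ones stand before `g`, so passing from `f` to `g` drops leading ones and cannot
        -- increase the factor.
        between f l with f≤g ← max f (n , _ , _ , c , l) =
          subst (λ u → ¬ Less (suc n) f u) (m∸n+n≡m f≤g)
            (≮-shifts (suc n) f (g ∸ f) λ j h →
              above-ones v j (subst (j <_) (m∸n+n≡m f≤g) h))

      -- The words 1c extend one another, so lengthening c does not move the first difference from
      -- the suffix at `g`.
      same-diff : ∀ {n p q d′} → m ≤ n → Cross 0 n p q →
        Agree d′ (suc p) g → x (d′ + suc p) < x (d′ + g) → d′ ≡ d
      same-diff {p = p} {d′ = d′} m≤n c a h with <-cmp d′ d
      ... | tri≈ _ e _ = e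
      ... | tri< d′<d _ _ = ⊥-elim (<-irrefl (trans
              (sym (agree-at (coherent₁ ĉ c m≤n) (<-trans d′<d d<1+m)))
              (agree-at â d′<d)) h)
      ... | tri> _ _ d<d′ = ⊥-elim (<-irrefl (trans
              (agree-at (coherent₁ ĉ c m≤n) d<1+m) (agree-at a d<d′)) d<)

      shifted : ∀ {r p q} → m ≤ d + r → Cross 0 (suc d + r) p q →
        Agree r (2 + p) (2 + d + suc p) × Agree r (2 + d + suc p) (2 + d + g)
      shifted {r} {p} {q} m≤d+r c with nice-diff (nice (least (m≤n⇒m≤1+n m≤d+r) c))
      ... | d′ , a , h , tail with same-diff (m≤n⇒m≤1+n m≤d+r) c a h
      shifted {r} {p} {q} m≤d+r c | .d , a , h , inj₁ e | refl =
        ⊥-elim (<⇒≱ d<1+m (≤-trans (s≤s m≤d+r) (≤-reflexive (sym (suc-injective e)))))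
      shifted {r} {p} {q} m≤d+r c | .d , a , h , inj₂ (r′ , e , f , f′ , b) | refl
        with refl ← +-cancelˡ-≡ (2 + d) r r′ e with <⇒0,1 h
      ... | u₀ , u₁ = same , b
        where
        short : 2 + r ≤ 2 + (suc d + r)
        short = s≤s (s≤s (m≤n+m r (suc d)))
        -- The common tail follows 01 inside 1c and follows 10 in the suffix at `g`. As 01c is
        -- greatest and 10c least, the tail is neither above nor below c.
        low : ¬ Less r (2 + p) (2 + d + suc p)
        low l = ≤p c u₀ (less-extend short
          (there (trans (p₀ c) (sym u₀)) (there (trans (p₁ c) (sym (trans f u₁))) l)))
        high : ¬ Less r (2 + d + g) (2 + q)
        high l = q≤ c u₁ (less-extend short
          (there (trans u₁ (sym (q₀ c))) (there (trans (trans f′ u₀) (sym (q₁ c))) l)))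
        same : Agree r (2 + p) (2 + d + suc p)
        same with compare′ r (2 + p) (2 + d + suc p)
        ... | inj₁ l        = ⊥-elim (low l)
        ... | inj₂ (inj₁ s) = s
        ... | inj₂ (inj₂ l) = ⊥-elim (high (agree-less (agree-sym b)
                (less-agree l (agree-take (m≤n+m r (suc d)) (agree c)))))

      recur : ∀ t → x (t + (2 + d + g) + suc d) ≡ x (t + (2 + d + g))
      recur t = decidable-stable (_ ≟ _) λ ≢ →
        cross (suc d + r) 0 occ₀ occ₁ λ (p , q , c) → ≢ (eq c)
        where
        r : ℕ
        -- Long enough to contain the index `suc d + t` and to reach the length `m` from which
        -- `least` applies.
        r = suc (suc d + t) + m
        eq : Cross 0 (suc d + r) p q → x (t + (2 + d + g) + suc d) ≡ x (t + (2 + d + g))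
        eq {p} c with shifted (≤-trans (m≤n+m m _) (m≤n+m r d)) c
        ... | a , b = begin
          x (t + (2 + d + g) + suc d)     ≡⟨ cong x (arith₁ t d g) ⟩
          x (suc d + t + (2 + d + g))     ≡⟨ sym (agree-at b s<r) ⟩
          x (suc d + t + (2 + d + suc p)) ≡⟨ sym (agree-at a s<r) ⟩
          x (suc d + t + (2 + p))         ≡⟨ cong x (arith₂ t d p) ⟩
          x (t + (2 + d + suc p))         ≡⟨ agree-at b (≤-<-trans (m≤n+m t (suc d)) s<r) ⟩
          x (t + (2 + d + g))             ∎
          where
          open ≡-Reasoning
          s<r : suc d + t < r
          s<r = m≤m+n (suc (suc d + t)) m
          arith₁ : ∀ t d g → t + (2 + d + g) + suc d ≡ suc d + t + (2 + d + g)
          arith₁ = solve-∀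
          arith₂ : ∀ t d p → suc d + t + (2 + p) ≡ t + (2 + d + suc p)
          arith₂ = solve-∀

-- NFOp implies aperiodicity and balance.

module Binary (x : ℕ → ℕ) (x≤1 : ∀ i → x i ≤ 1)
  (nice : ∀ {n i j} → Seq.Succ x n i j → Seq.Nice x n i j)
  (occ₀ : ∃[ i ] x i ≡ 0) (occ₁ : ∃[ i ] x i ≡ 1) where

  open Seq x
  open Bounded 2 (λ i → s≤s (x≤1 i))
  open Ordered x 2 (λ i → s≤s (x≤1 i)) nice using (Cross; cross)

  aperiodic : ¬ Periodic
  aperiodic per = 0≢1+n (trans (sym (proj₂ occ₀))
    (trans (constant (proj₁ occ₀)) (trans (sym (constant (proj₁ occ₁))) (proj₂ occ₁))))
    where
    constant : ∀ i → x i ≡ x 0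
    constant zero    = refl
    constant (suc i) = trans (sym (periodic⇒constant nice per i)) (constant i)

  -- Exchanging 0 and 1 reverses the order and the roles of 01c and 10c. Applied to the complement,
  -- `¬above` says that no factor lies below 0c.
  x̄ : ℕ → ℕ
  x̄ i = 1 ∸ x i

  module X̄ = Seq x̄

  private variable n i j : ℕ

  flip-< : x̄ i < x̄ j → x j < x i
  flip-< h = ≰⇒> λ x≤ → <⇒≱ h (∸-monoʳ-≤ 1 x≤)

  flip-≡ : x̄ i ≡ x̄ j → x i ≡ x j
  flip-≡ {i} {j} = ∸-cancelˡ-≡ (x≤1 i) (x≤1 j)

  unflip-< : x i < x j → x̄ j < x̄ i
  unflip-< {i} {j} h = ∸-monoʳ-< h (x≤1 j)

  flip-less : X̄.Less n i j → Less n j i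
  flip-less (X̄.here h)    = here (flip-< h)
  flip-less (X̄.there e l) = there (sym (flip-≡ e)) (flip-less l)

  unflip-less : Less n i j → X̄.Less n j i
  unflip-less (here h)    = X̄.here (unflip-< h)
  unflip-less (there e l) = X̄.there (cong (1 ∸_) (sym e)) (unflip-less l)

  flip-agree : Agree n i j → X̄.Agree n j i
  flip-agree []       = X̄.[]
  flip-agree (e ∷ es) = cong (1 ∸_) (sym e) X̄.∷ flip-agree es

  flip-nice : Nice n i j → X̄.Nice n j i
  flip-nice (last h)       = X̄.last (unflip-< h)
  flip-nice (swap h e f a) =
    X̄.swap (unflip-< h) (cong (1 ∸_) f) (cong (1 ∸_) e) (flip-agree a)
  flip-nice (skip e s)     = X̄.skip (cong (1 ∸_) (sym e)) (flip-nice s)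

  flip-succ : X̄.Succ n i j → Succ n j i
  flip-succ (l , b) = flip-less l , λ f u v → b f (unflip-less v) (unflip-less u)

  unflip-succ : Succ n i j → X̄.Succ n j i
  unflip-succ (l , b) = unflip-less l , λ f u v → b f (flip-less v) (flip-less u)

  x̄-nice : X̄.Succ n i j → X̄.Nice n i j
  x̄-nice s = flip-nice (nice (flip-succ s))

  x̄-aperiodic : ¬ X̄.Periodic
  x̄-aperiodic (N , p , h , per) = aperiodic (N , p , h , λ n N≤n → flip-≡ (per n N≤n))

  x̄≤1 : ∀ i → x̄ i ≤ 1
  x̄≤1 i = m∸n≤m 1 (x i)

  x̄-occ₀ : ∃[ i ] x̄ i ≡ 0
  x̄-occ₀ = proj₁ occ₁ , cong (1 ∸_) (proj₂ occ₁)

  x̄-occ₁ : ∃[ i ] x̄ i ≡ 1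
  x̄-occ₁ = proj₁ occ₀ , cong (1 ∸_) (proj₂ occ₀)

  module E = Extremal x x≤1 nice occ₀ occ₁ aperiodic
  module Ē = Extremal x̄ x̄≤1 x̄-nice x̄-occ₀ x̄-occ₁ x̄-aperiodic
  module Ō = Ordered x̄ 2 (λ i → s≤s (x̄≤1 i)) x̄-nice

  flip-cross : ∀ {n p q} → Cross 0 n p q → Ō.Cross 0 n q p
  flip-cross c = record
    { succ = unflip-succ succ ; p₀ = cong (1 ∸_) q₀ ; p₁ = cong (1 ∸_) q₁
    ; q₀ = cong (1 ∸_) p₀ ; q₁ = cong (1 ∸_) p₁ ; agree = flip-agree agree }
    where open Cross c

  -- All factors of length n + 1 lie between 0c and 1c, and weights grow along the
  -- lexicographic order.
  wt-balanced : ∀ n i j → wt n i ≤ suc (wt n j)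
  wt-balanced zero    i j = z≤n
  wt-balanced (suc n) i j = decidable-stable (_ ≤? _) λ ≰ →
    cross n 0 occ₀ occ₁ λ (p , q , c) → ≰ (between c)
    where
    open ≤-Reasoning
    between : ∀ {p q} → Cross 0 n p q → wt (suc n) i ≤ suc (wt (suc n) j)
    between {p} {q} c = begin
      wt (suc n) i                       ≤⟨ ≮⇒wt≤ nice (λ l → E.¬above (p , q , c , l)) ⟩
      x (suc p) + wt n (2 + p)           ≡⟨ cong (_+ wt n (2 + p)) p₁ ⟩
      suc (wt n (2 + p))                 ≡⟨ cong suc (wt-agree agree) ⟩
      suc (wt n (2 + q))                 ≡⟨ cong (λ u → suc (u + wt n (2 + q))) (sym q₁) ⟩
      suc (wt (suc n) (suc q))           ≤⟨ s≤s (≮⇒wt≤ nice λ l →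
                                              Ē.¬above (q , p , flip-cross c , unflip-less l)) ⟩
      suc (wt (suc n) j)                 ∎
      where open Cross c

-- Residues and sums.

%-far : ∀ {a b m} .{{_ : NonZero m}} → a % m ≡ b % m → a / m < b / m → a + m ≤ b
%-far {a} {b} {m} e q = begin
  a + m                     ≡⟨ cong (_+ m) (m≡m%n+[m/n]*n a m) ⟩
  a % m + (a / m) * m + m   ≡⟨ +-assoc (a % m) _ m ⟩
  a % m + ((a / m) * m + m) ≡⟨ cong₂ _+_ e (+-comm _ m) ⟩
  b % m + suc (a / m) * m   ≤⟨ +-monoʳ-≤ (b % m) (*-monoˡ-≤ m q) ⟩
  b % m + (b / m) * m       ≡⟨ sym (m≡m%n+[m/n]*n b m) ⟩
  b                         ∎
  where open ≤-Reasoning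

%-injective : ∀ {a b m} .{{_ : NonZero m}} → a < b + m → b < a + m → a % m ≡ b % m → a ≡ b
%-injective {a} {b} {m} a<b+m b<a+m e with <-cmp (a / m) (b / m)
... | tri< q _ _ = ⊥-elim (<⇒≱ b<a+m (%-far e q))
... | tri> _ _ q = ⊥-elim (<⇒≱ a<b+m (%-far (sym e) q))
... | tri≈ _ q _ = begin
  a                   ≡⟨ m≡m%n+[m/n]*n a m ⟩
  a % m + (a / m) * m ≡⟨ cong₂ (λ r q → r + q * m) e q ⟩
  b % m + (b / m) * m ≡⟨ sym (m≡m%n+[m/n]*n b m) ⟩
  b                   ∎
  where open ≡-Reasoning

-- Indices run from 1 to `n`, matching the nonempty prefixes of a factor of length `n`.
∑ : (ℕ → ℕ) → ℕ → ℕ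
∑ f zero    = 0
∑ f (suc n) = ∑ f n + f (suc n)

∑-mono : ∀ {f g} n → (∀ t → t ≤ n → f t ≤ g t) → ∑ f n ≤ ∑ g n
∑-mono zero    h = z≤n
∑-mono (suc n) h = +-mono-≤ (∑-mono n λ t l → h t (m≤n⇒m≤1+n l)) (h (suc n) ≤-refl)

∑-mono-< : ∀ {f g} n → (∀ t → t ≤ n → f t ≤ g t) →
  ∀ s → 1 ≤ s → s ≤ n → f s < g s → ∑ f n < ∑ g n
∑-mono-< zero    h s 1≤s s≤0 f<g = ⊥-elim (<⇒≱ 1≤s s≤0)
∑-mono-< (suc n) h s 1≤s s≤n f<g with m≤n⇒m<n∨m≡n s≤n
... | inj₁ l    = +-mono-<-≤
  (∑-mono-< n (λ t l → h t (m≤n⇒m≤1+n l)) s 1≤s (s≤s⁻¹ l) f<g) (h (suc n) ≤-refl)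
... | inj₂ refl = +-mono-≤-< (∑-mono n λ t l → h t (m≤n⇒m≤1+n l)) f<g

-- Meant for prefix weights: if two of them grew between consecutive factors, the height would grow
-- by at least 2, against `height-succ`.
∑-mono-<< : ∀ {f g} n → (∀ t → t ≤ n → f t ≤ g t) →
  ∀ s s′ → 1 ≤ s → s < s′ → s′ ≤ n → f s < g s → f s′ < g s′ → 2 + ∑ f n ≤ ∑ g n
∑-mono-<< zero    h s s′ 1≤s s<s′ s′≤0 _ _ = ⊥-elim (<⇒≱ s<s′ (≤-trans s′≤0 z≤n))
∑-mono-<< {f} {g} (suc n) h s s′ 1≤s s<s′ s′≤n f<g f<g′ with m≤n⇒m<n∨m≡n s′≤n
... | inj₁ l    = +-mono-≤
  (∑-mono-<< n (λ t l → h t (m≤n⇒m≤1+n l)) s s′ 1≤s s<s′ (s≤s⁻¹ l) f<g f<g′) (h (suc n) ≤-refl)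
... | inj₂ refl = subst (_≤ ∑ g (suc n)) (cong suc (+-suc (∑ f n) (f (suc n)))) (+-mono-≤
  (∑-mono-< n (λ t l → h t (m≤n⇒m≤1+n l)) s 1≤s (s≤s⁻¹ s<s′) f<g) f<g′)

-- Aperiodic balanced binary words have NFOp.

module AperiodicBalanced (x : ℕ → ℕ) (x≤1 : ∀ i → x i ≤ 1) (aperiodic : ¬ Seq.Periodic x)
  (balanced : ∀ n i j → Seq.wt x n i ≤ suc (Seq.wt x n j)) where

  open Seq x
  open Bounded 2 (λ i → s≤s (x≤1 i))

  private variable n i j : ℕ

  -- A right special factor. Pigeonhole on `2 ^ n + 1` positions gives one factor at `i₀` and `j₀`;
  -- if factors of length `n` always determined the next letter, the agreement would propagate
  -- forever and `j₀ ∸ i₀` would be a period.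
  special : ∀ n → ¬ ¬ (∃₂ λ p q → Agree n p q × x (n + p) ≢ x (n + q))
  special n k with Fin.pigeonhole (n<1+n (2 ^ n))
    (λ (r : Fin (suc (2 ^ n))) → fromℕ< (val<B^n n (toℕ r)))
  ... | r , s , r<s , e = aperiodic (n + i₀ , j₀ ∸ i₀ , m<n⇒0<n∸m r<s , recur)
    where
    i₀ j₀ : ℕ
    i₀ = toℕ r
    j₀ = toℕ s
    recurrence : ∀ t → Agree n (t + i₀) (t + j₀)
    recurrence zero = val-injective n (Fin.fromℕ<-injective _ _ _ _ e)
    recurrence (suc t) with a ← recurrence t
      with _ ∷ a′ ← agree-snoc a (decidable-stable (x (n + (t + i₀)) ≟ x (n + (t + j₀)))
                      λ ≢ → k (t + i₀ , t + j₀ , a , ≢)) = a′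
    recur : ∀ m → n + i₀ ≤ m → x (m + (j₀ ∸ i₀)) ≡ x m
    recur m n+i₀≤m = begin
      x (m + (j₀ ∸ i₀))             ≡⟨ cong (λ u → x (u + (j₀ ∸ i₀))) (sym t+n+i₀) ⟩
      x (t + (n + i₀) + (j₀ ∸ i₀))   ≡⟨ cong x (arith t n i₀ (j₀ ∸ i₀)) ⟩
      x (n + (t + (i₀ + (j₀ ∸ i₀)))) ≡⟨ cong (λ u → x (n + (t + u))) (m+[n∸m]≡n (<⇒≤ r<s)) ⟩
      x (n + (t + j₀))             ≡⟨ sym (decidable-stable (x (n + (t + i₀)) ≟ x (n + (t + j₀)))
                                       λ ≢ → k (t + i₀ , t + j₀ , recurrence t , ≢)) ⟩
      x (n + (t + i₀))             ≡⟨ cong x (arith′ n t i₀) ⟩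
      x (t + (n + i₀))             ≡⟨ cong x t+n+i₀ ⟩
      x m                         ∎
      where
      open ≡-Reasoning
      t : ℕ
      t = m ∸ (n + i₀)
      t+n+i₀ : t + (n + i₀) ≡ m
      t+n+i₀ = m∸n+n≡m n+i₀≤m
      arith : ∀ t n u d → t + (n + u) + d ≡ n + (t + (u + d))
      arith = solve-∀
      arith′ : ∀ n t u → n + (t + u) ≡ t + (n + u)
      arith′ = solve-∀

  -- At least n + 1 factors of length n, as in the theorem of Morse and Hedlund.
  Distinct : ℕ → Set
  Distinct n = Σ[ f ∈ (Fin (suc n) → ℕ) ] (∀ r s → Agree n (f r) (f s) → r ≡ s)

  extend : ((f , _) : Distinct n) → ∀ g → (∀ r → ¬ Agree (suc n) g (f r)) → Distinct (suc n)
  extend {n} (f , distinct) g new = f′ , distinct′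
    where
    f′ : Fin (2 + n) → ℕ
    f′ Fin.zero    = g
    f′ (Fin.suc r) = f r
    distinct′ : ∀ r s → Agree (suc n) (f′ r) (f′ s) → r ≡ s
    distinct′ Fin.zero    Fin.zero    _ = refl
    distinct′ Fin.zero    (Fin.suc s) a = ⊥-elim (new s a)
    distinct′ (Fin.suc r) Fin.zero    a = ⊥-elim (new r (agree-sym a))
    distinct′ (Fin.suc r) (Fin.suc s) a = cong Fin.suc (distinct r s (agree-init a))

  -- Listed positions already differ on `n` letters, so both extensions of a right special factor
  -- could match only one and the same listed position, which is absurd. Hence one extension is new.
  many-factors : ∀ n → ¬ ¬ Distinct n
  many-factors zero    k = k ((λ _ → 0) , λ { Fin.zero Fin.zero _ → refl })
  many-factors (suc n) k = many-factors n λ D → special n λ (p , q , a , ≢) → step D p q a ≢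
    where
    step : Distinct n → ∀ p q → Agree n p q → x (n + p) ≢ x (n + q) → ⊥
    step D@(f , distinct) p q a ≢ with Fin.any? (λ r → agree? (suc n) p (f r))
                                   | Fin.any? (λ r → agree? (suc n) q (f r))
    ... | no new      | _      = k (extend D p λ r a → new (r , a))
    ... | yes _       | no new = k (extend D q λ r a → new (r , a))
    ... | yes (r , b) | yes (s , c) with refl ← distinct r s (agree-trans (agree-sym (agree-init b))
            (agree-trans a (agree-init c))) = ≢ (trans (agree-at b ≤-refl) (sym (agree-at c ≤-refl)))

  -- The gain at the first difference absorbs the loss of at most 1 that balance allows on what
  -- follows.
  prefix-wt-mono : Less n i j → ∀ t → t ≤ n → wt t i ≤ wt t j
  prefix-wt-mono l zero _ = z≤n
  prefix-wt-mono {i = i} {j} (here h) (suc t) (s≤s _) = begin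
    x i + wt t (suc i)       ≤⟨ +-monoʳ-≤ (x i) (balanced t (suc i) (suc j)) ⟩
    x i + suc (wt t (suc j)) ≡⟨ +-suc (x i) _ ⟩
    suc (x i) + wt t (suc j) ≤⟨ +-monoˡ-≤ (wt t (suc j)) h ⟩
    x j + wt t (suc j)       ∎
    where open ≤-Reasoning
  prefix-wt-mono (there e l) (suc t) (s≤s h) =
    +-mono-≤ (≤-reflexive e) (prefix-wt-mono l t h)

  wts-agree : ∀ n → (∀ t → t ≤ n → wt t i ≡ wt t j) → Agree n i j
  wts-agree {i} {j} n h = at-agree n λ t t<n → +-cancelˡ-≡ (wt t i) _ _ (begin
    wt t i + x (t + i) ≡⟨ sym (wt-snoc t i) ⟩
    wt (suc t) i       ≡⟨ h (suc t) t<n ⟩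
    wt (suc t) j       ≡⟨ wt-snoc t j ⟩
    wt t j + x (t + j) ≡⟨ cong (_+ x (t + j)) (sym (h t (<⇒≤ t<n))) ⟩
    wt t i + x (t + j) ∎)
    where open ≡-Reasoning

  -- In a balanced word the prefix weights of two factors differ by 0 or 1, always with
  -- the same sign, so heights spread over at most n + 1 values and determine the factor.
  height : ℕ → ℕ → ℕ
  height n i = ∑ (λ t → wt t i) n

  -- No prefix weight drops, and the prefix that ends at the first difference gains.
  height-mono : Less n i j → height n i < height n j
  height-mono {n} {i} {j} l with d , d<n , a , h ← less-diff l =
    ∑-mono-< n (prefix-wt-mono l) (suc d) (s≤s z≤n) d<n
      (subst₂ _<_ (sym (wt-snoc d i)) (sym (wt-snoc d j))
        (+-mono-≤-< (≤-reflexive (wt-agree a)) h))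

  height-injective : height n i ≡ height n j → Agree n i j
  height-injective {n} {i} {j} e with compare′ n i j
  ... | inj₁ l        = ⊥-elim (<-irrefl e (height-mono l))
  ... | inj₂ (inj₁ a) = a
  ... | inj₂ (inj₂ l) = ⊥-elim (<-irrefl (sym e) (height-mono l))

  agree-height : Agree n i j → height n i ≡ height n j
  agree-height {n} a = ≤-antisym
    (∑-mono n λ t h → ≤-reflexive (wt-agree (agree-take h a)))
    (∑-mono n λ t h → ≤-reflexive (sym (wt-agree (agree-take h a))))

  -- Balance contributes at most 1 for each of the `n` prefixes. The strict bound with `suc n` is
  -- the form that `%-injective` takes.
  height-range : ∀ n i j → height n i < height n j + suc n
  height-range zero    i j = z<s
  height-range (suc n) i j = begin-strict
    height n i + wt (suc n) i           <⟨ +-mono-<-≤ (height-range n i j) (balanced (suc n) i j) ⟩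
    height n j + suc n + suc (wt (suc n) j) ≡⟨ arith (height n j) n (wt (suc n) j) ⟩
    height (suc n) j + suc (suc n)      ∎
    where
    open ≤-Reasoning
    arith : ∀ h n w → h + suc n + suc w ≡ h + w + suc (suc n)
    arith = solve-∀

  -- The at least n + 1 heights are distinct modulo n + 1, so they fill all residues.
  height-succ : Succ n i j → height n j ≡ suc (height n i)
  height-succ {n} {i} {j} (ij , between) =
    decidable-stable (height n j ≟ suc (height n i)) λ ≢ → many-factors n λ D →
      missed D (≤∧≢⇒< (height-mono ij) (λ e → ≢ (sym e)))
    where
    H : ℕ → ℕ
    H = height n
    missed : Distinct n → suc (H i) < H j → ⊥
    missed (f , distinct) gap = collide (Fin.pigeonhole (n<1+n n) λ r → punchOut (avoid r))
      where
      residue : ℕ → Fin (suc n)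
      residue h = fromℕ< (m%n<n h (suc n))
      residue-injective : ∀ {a b} → a < b + suc n → b < a + suc n → residue a ≡ residue b → a ≡ b
      residue-injective h h′ e = %-injective h h′ (Fin.fromℕ<-injective _ _ _ _ e)
      -- Heights follow the order, so a factor of height `suc (H i)` would lie strictly between `i`
      -- and `j`.
      skipped : ∀ p → H p ≢ suc (H i)
      skipped p e with compare′ n i p | compare′ n p j
      ... | inj₁ ip        | inj₁ pj        = between p ip pj
      ... | inj₂ (inj₂ pi) | _ = <⇒≱ (height-mono pi) (≤-trans (n≤1+n _) (≤-reflexive (sym e)))
      ... | inj₂ (inj₁ a)  | _ = 1+n≢n (trans (sym e) (sym (agree-height a)))
      ... | _ | inj₂ (inj₁ a)  = <⇒≱ gap (≤-reflexive (trans (sym (agree-height a)) e))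
      ... | _ | inj₂ (inj₂ jp) = <⇒≱ gap (<⇒≤ (subst (H j <_) e (height-mono jp)))
      avoid : ∀ r → residue (suc (H i)) ≢ residue (H (f r))
      avoid r e = skipped (f r) (sym (residue-injective
        (<-trans gap (height-range n j (f r)))
        (m<n⇒m<1+n (height-range n (f r) i)) e))
      -- The `n + 1` distinct heights would have to share the `n` residues other than that of
      -- `suc (H i)`.
      collide : ∃₂ (λ r s → r Fin.< s × punchOut (avoid r) ≡ punchOut (avoid s)) → ⊥
      collide (r , s , r<s , e) = Fin.<⇒≢ r<s (distinct r s (height-injective (residue-injective
        (height-range n (f r) (f s)) (height-range n (f s) (f r))
        (Fin.punchOut-injective (avoid r) (avoid s) e))))

  -- The first difference, 0 against 1, already raises one prefix weight, so all longer prefixes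
  -- have equal weights. The next letters must then be 1 against 0, and the rest must agree.
  single-step : Less n i j →
    (∀ s t → 1 ≤ s → s < t → t ≤ n → wt s i < wt s j → ¬ wt t i < wt t j) → Nice n i j
  single-step (there e l) u = skip e (single-step l λ s t 1≤s s<t t≤n h h′ →
    u (suc s) (suc t) (s≤s z≤n) (s≤s s<t) (s≤s t≤n) (lift h) (lift h′))
    where
    lift : ∀ {a b} → a < b → _
    lift h = +-mono-≤-< (≤-reflexive e) h
  single-step {suc zero}    (here h) u = last h
  single-step {suc (suc n)} {i} {j} (here h) u
    with e ← n<1⇒n≡0 (<-≤-trans h (x≤1 j)) | f ← ≤-antisym (x≤1 j) (≤-trans (s≤s z≤n) h) =
    swap h (trans e₁ (sym f)) (trans f₁ (sym e)) (wts-agree n λ t t≤n → suc-injective (begin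
      suc (wt t (2 + i))              ≡⟨ sym (cong₂ (λ u v → u + (v + wt t (2 + i))) e e₁) ⟩
      wt (2 + t) i                    ≡⟨ eq (s≤s (s≤s z≤n)) (s≤s (s≤s t≤n)) ⟩
      wt (2 + t) j                    ≡⟨ cong₂ (λ u v → u + (v + wt t (2 + j))) f f₁ ⟩
      suc (wt t (2 + j))              ∎))
    where
    open ≡-Reasoning
    eq : ∀ {t} → 1 < t → t ≤ 2 + n → wt t i ≡ wt t j
    eq {t} 1<t t≤n = ≤-antisym (prefix-wt-mono (here h) t t≤n)
      (≮⇒≥ (u 1 t ≤-refl 1<t t≤n (+-monoˡ-< 0 h)))
    pair : x (suc i) + 0 ≡ suc (x (suc j) + 0)
    pair = trans (cong (_+ (x (suc i) + 0)) (sym e))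
      (trans (eq ≤-refl (s≤s (s≤s z≤n))) (cong (_+ (x (suc j) + 0)) f))
    pair′ : x (suc i) ≡ suc (x (suc j))
    pair′ = trans (sym (+-identityʳ _)) (trans pair (cong suc (+-identityʳ _)))
    f₁ : x (suc j) ≡ 0
    f₁ = n≤0⇒n≡0 (s≤s⁻¹ (subst (_≤ 1) pair′ (x≤1 (suc i))))
    e₁ : x (suc i) ≡ 1
    e₁ = trans pair′ (cong suc f₁)

  nice : Succ n i j → Nice n i j
  nice {n} s@(l , _) = single-step l λ p q 1≤p p<q q≤n h h′ →
    <-irrefl refl (subst (2 + _ ≤_) (height-succ s)
      (∑-mono-<< n (prefix-wt-mono l) p q 1≤p p<q q≤n h h′))

-- Translation between words and windows.

module Blocks {k : ℕ} (w : InfWord k) where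

  x : ℕ → ℕ
  x n = toℕ (w n)

  open Seq x

  private variable n i j : ℕ

  -- Recursion on the position makes the tail of a block a block by definition, which `applyUpTo`
  -- does not.
  block : ℕ → ℕ → Word k
  block zero    i = []
  block (suc n) i = w i ∷ block n (suc i)

  length-block : ∀ n i → length (block n i) ≡ n
  length-block zero    i = refl
  length-block (suc n) i = cong suc (length-block n (suc i))

  applyUpTo-block : ∀ n i {f} → (∀ j → f j ≡ w (i + j)) → applyUpTo f n ≡ block n i
  applyUpTo-block zero    i h = refl
  applyUpTo-block (suc n) i h = cong₂ _∷_
    (trans (h 0) (cong w (+-identityʳ i)))
    (applyUpTo-block n (suc i) λ j → trans (h (suc j)) (cong w (+-suc i j)))

  block-factor : ∀ n i → Factor w (block n i)
  block-factor n i = i , n , sym (applyUpTo-block n i λ _ → refl)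

  factor-block : ∀ {v} → Factor w v → ∃₂ λ n i → v ≡ block n i
  factor-block (i , n , e) = n , i , trans e (applyUpTo-block n i λ _ → refl)

  same-length : ∀ m n {i j} → length (block m i) ≡ length (block n j) → m ≡ n
  same-length m n {i} {j} e = trans (sym (length-block m i)) (trans e (length-block n j))

  agree⇒≡ : Agree n i j → block n i ≡ block n j
  agree⇒≡ []       = refl
  agree⇒≡ (e ∷ es) = cong₂ _∷_ (Fin.toℕ-injective e) (agree⇒≡ es)

  ≡⇒agree : ∀ n {i j} → block n i ≡ block n j → Agree n i j
  ≡⇒agree zero    _ = []
  ≡⇒agree (suc n) e = cong toℕ (∷-injectiveˡ e) ∷ ≡⇒agree n (∷-injectiveʳ e)

  less⇒lex : Less n i j → block n i <lex block n j
  less⇒lex {n} {i} {j} l = trans (length-block n i) (sym (length-block n j)) , go l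
    where
    go : ∀ {n i j} → Less n i j → ∃[ l ] ∃[ a ] ∃[ b ]
      a Fin.< b × Prefix _≡_ (l ++ [ a ]) (block n i) × Prefix _≡_ (l ++ [ b ]) (block n j)
    go {i = i} {j} (here h) = [] , w i , w j , h , refl ∷ [] , refl ∷ []
    go {i = i} (there e l) with u , a , b , a<b , p , q ← go l =
      w i ∷ u , a , b , a<b , refl ∷ p , Fin.toℕ-injective e ∷ q

  lex⇒less : block n i <lex block n j → Less n i j
  lex⇒less {n} (_ , u , a , b , a<b , p , q) = go n u p q
    where
    go : ∀ n {i j} u → Prefix _≡_ (u ++ [ a ]) (block n i) →
      Prefix _≡_ (u ++ [ b ]) (block n j) → Less n i j
    go (suc n) []      (refl ∷ _) (refl ∷ _) = here a<b
    go (suc n) (c ∷ u) (e ∷ p)    (f ∷ q)    =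
      there (cong toℕ (trans (sym e) f)) (go n u p q)

  nice⇒step : Nice n i j → ∃[ a ] ∃[ b ] a Fin.< b × NiceStep a b (block n i) (block n j)
  nice⇒step {i = i} {j} (last h) = w i , w j , h , inj₂ ([] , refl , refl)
  nice⇒step {i = i} {j} (swap {n = n} h e f a) = w i , w j , h , inj₁ ([] , block n (2 + i)
    , cong (λ c → w i ∷ c ∷ block n (2 + i)) (Fin.toℕ-injective e)
    , cong₂ (λ c u → w j ∷ c ∷ u) (Fin.toℕ-injective f) (sym (agree⇒≡ a)))
  nice⇒step {i = i} (skip e s) with nice⇒step s
  ... | a , b , h , inj₁ (u , v , p , q) =
    a , b , h , inj₁ (w i ∷ u , v , cong (w i ∷_) p , cong₂ _∷_ (sym (Fin.toℕ-injective e)) q)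
  ... | a , b , h , inj₂ (u , p , q) =
    a , b , h , inj₂ (w i ∷ u , cong (w i ∷_) p , cong₂ _∷_ (sym (Fin.toℕ-injective e)) q)

  step⇒nice : ∀ n {a b} → a Fin.< b → NiceStep a b (block n i) (block n j) → Nice n i j
  step⇒nice n {a} {b} a<b (inj₁ (u , v , p , q)) = go n u p q
    where
    go : ∀ n {i j} u → block n i ≡ u ++ a ∷ b ∷ v → block n j ≡ u ++ b ∷ a ∷ v → Nice n i j
    go (suc n) (c ∷ u) p q = skip
      (cong toℕ (trans (∷-injectiveˡ p) (sym (∷-injectiveˡ q))))
      (go n u (∷-injectiveʳ p) (∷-injectiveʳ q))
    go (suc (suc n)) [] p q with refl ← ∷-injectiveˡ p | refl ← ∷-injectiveˡ q
      with p′ ← ∷-injectiveʳ p | q′ ← ∷-injectiveʳ q =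
      swap a<b (cong toℕ (∷-injectiveˡ p′)) (cong toℕ (∷-injectiveˡ q′))
        (≡⇒agree n (trans (∷-injectiveʳ p′) (sym (∷-injectiveʳ q′))))
  step⇒nice n {a} {b} a<b (inj₂ (u , p , q)) = go n u p q
    where
    go : ∀ n {i j} u → block n i ≡ u ++ [ a ] → block n j ≡ u ++ [ b ] → Nice n i j
    go (suc n) (c ∷ u) p q = skip
      (cong toℕ (trans (∷-injectiveˡ p) (sym (∷-injectiveˡ q))))
      (go n u (∷-injectiveʳ p) (∷-injectiveʳ q))
    go (suc zero) [] refl refl = last a<b

  succ⇒isSucc : Succ n i j → IsSucc w (block n i) (block n j)
  succ⇒isSucc {n} {i} {j} (l , between) =
    block-factor n i , block-factor n j , less⇒lex l , no-between
    where
    no-between : ¬ (∃[ f ] Factor w f × block n i <lex f × f <lex block n j)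
    no-between (f , F , l , l′) with m , g , refl ← factor-block F
      with refl ← same-length n m (proj₁ l) = between g (lex⇒less l) (lex⇒less l′)

  isSucc⇒succ : IsSucc w (block n i) (block n j) → Succ n i j
  isSucc⇒succ {n} (_ , _ , l , no-between) = lex⇒less l , λ f l l′ →
    no-between (block n f , block-factor n f , less⇒lex l , less⇒lex l′)

  NFOp₁⇒nice : NFOp₁ w → Succ n i j → Nice n i j
  NFOp₁⇒nice {n} {i} {j} p s with a , b , a<b , step ← p _ _ (succ⇒isSucc s) =
    step⇒nice n a<b step

  nice⇒NFOp₁ : (∀ {n i j} → Succ n i j → Nice n i j) → NFOp₁ w
  nice⇒NFOp₁ nice v v′ S@(F , F′ , l , _) with factor-block F | factor-block F′
  ... | n , i , refl | m , j , refl with refl ← same-length n m (proj₁ l) =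
    nice⇒step (nice (isSucc⇒succ S))

  periodic⇒ultimately : Periodic → UltimatelyPeriodic w
  periodic⇒ultimately (N , p , h , per) = N , p , h , λ n N≤n → Fin.toℕ-injective (per n N≤n)

  ultimately⇒periodic : UltimatelyPeriodic w → Periodic
  ultimately⇒periodic (N , p , h , per) = N , p , h , λ n N≤n → cong toℕ (per n N≤n)

  module _ (x≤1 : ∀ i → x i ≤ 1) where

    occurrences-1 : ∀ a → toℕ a ≡ 1 → ∀ n i → occurrences a (block n i) ≡ wt n i
    occurrences-1 a e zero    i = refl
    occurrences-1 a e (suc n) i with a Fin.≟ w i
    ... | yes refl = cong₂ _+_ (sym e) (occurrences-1 a e n (suc i))
    ... | no a≢wi  = cong₂ _+_ (sym x≡0) (occurrences-1 a e n (suc i))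
      where
      x≡0 : x i ≡ 0
      x≡0 = n<1⇒n≡0 (≤∧≢⇒< (x≤1 i) λ f → a≢wi (Fin.toℕ-injective (trans e (sym f))))

    occurrences-0 : ∀ a → toℕ a ≡ 0 → ∀ n i → occurrences a (block n i) + wt n i ≡ n
    occurrences-0 a e zero    i = refl
    occurrences-0 a e (suc n) i with a Fin.≟ w i
    ... | yes refl = cong suc (trans (cong (λ u → occurrences (w i) (block n (suc i)) + (u + wt n (suc i))) e)
                       (occurrences-0 a e n (suc i)))
    ... | no a≢wi  = trans (cong (λ u → occurrences a (block n (suc i)) + (u + wt n (suc i))) x≡1)
                       (trans (+-suc _ _) (cong suc (occurrences-0 a e n (suc i))))
      where
      x≡1 : x i ≡ 1
      x≡1 = ≤-antisym (x≤1 i)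
        (n≢0⇒n>0 λ f → a≢wi (Fin.toℕ-injective (trans e (sym f))))

    balanced⇒wt : (∃[ a ] toℕ a ≡ 1) → Balanced w → ∀ n i j → wt n i ≤ suc (wt n j)
    balanced⇒wt (a , e) bal n i j = begin
      wt n i                           ≤⟨ m≤n+∣m-n∣ (wt n i) (wt n j) ⟩
      wt n j + ∣ wt n i - wt n j ∣     ≤⟨ +-monoʳ-≤ (wt n j) bound ⟩
      wt n j + 1                       ≡⟨ +-comm (wt n j) 1 ⟩
      suc (wt n j)                     ∎
      where
      open ≤-Reasoning
      bound : ∣ wt n i - wt n j ∣ ≤ 1
      bound = subst₂ (λ u v → ∣ u - v ∣ ≤ 1) (occurrences-1 a e n i) (occurrences-1 a e n j)
        (bal (block n i) (block n j) (block-factor n i) (block-factor n j)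
          (trans (length-block n i) (sym (length-block n j))) a)

    wt⇒balanced : k ≤ 1 → (∀ n i j → wt n i ≤ suc (wt n j)) → Balanced w
    wt⇒balanced k≤1 bal u u′ F F′ e a with factor-block F | factor-block F′
    ... | n , i , refl | m , j , refl with refl ← same-length n m e = close (bound i j) (bound j i)
      where
      close : ∀ {m n} → m ≤ suc n → n ≤ suc m → ∣ m - n ∣ ≤ 1
      close {m} {n} h h′ with ≤-total m n
      ... | inj₁ m≤n = subst (_≤ 1) (sym (m≤n⇒∣m-n∣≡n∸m m≤n))
        (m≤n+o⇒m∸n≤o n m (subst (n ≤_) (+-comm 1 m) h′))
      ... | inj₂ n≤m = subst (_≤ 1) (sym (m≤n⇒∣n-m∣≡n∸m n≤m))
        (m≤n+o⇒m∸n≤o m n (subst (m ≤_) (+-comm 1 n) h))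
      bound : ∀ i j → occurrences a (block n i) ≤ suc (occurrences a (block n j))
      bound i j with m≤n⇒m<n∨m≡n (≤-trans (Fin.toℕ≤pred[n] a) k≤1)
      ... | inj₂ e = subst₂ (λ u v → u ≤ suc v) (sym (occurrences-1 a e n i))
        (sym (occurrences-1 a e n j)) (bal n i j)
      -- The zeros number `n` minus the weight, so the weight bound enters with `i` and `j`
      -- exchanged.
      ... | inj₁ h with e ← n<1⇒n≡0 h = +-cancelʳ-≤ (wt n i) _ _ (begin
        occurrences a (block n i) + wt n i       ≡⟨ occurrences-0 a e n i ⟩
        n                                        ≡⟨ sym (occurrences-0 a e n j) ⟩
        occurrences a (block n j) + wt n j       ≤⟨ +-monoʳ-≤ _ (bal n j i) ⟩
        occurrences a (block n j) + suc (wt n i) ≡⟨ +-suc _ _ ⟩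
        suc (occurrences a (block n j)) + wt n i ∎)
        where open ≤-Reasoning

-- The forms of the property and the equivalence.

NFOp₃⇒NFOp₂ : ∀ {k} (w : InfWord k) → NFOp₃ w → NFOp₂ w
NFOp₃⇒NFOp₂ w (_ , p) v v′ S with a , b , e , f , step ← p v v′ S =
  a , b , trans f (cong suc (sym e)) , step

NFOp₂⇒NFOp₁ : ∀ {k} (w : InfWord k) → NFOp₂ w → NFOp₁ w
NFOp₂⇒NFOp₁ w p v v′ S with a , b , e , step ← p v v′ S = a , b , ≤-reflexive (sym e) , step

module _ {k : ℕ} (1≤k : 1 ≤ k) (w : InfWord k) (occurs : EveryLetterOccurs w) where

  open Blocks w

  letter : ∀ z → z ≤ k → ∃[ a ] toℕ {suc k} a ≡ z
  letter z z≤k = fromℕ< (s≤s z≤k) , Fin.toℕ-fromℕ< (s≤s z≤k)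

  occurs-ℕ : ∀ z → z ≤ k → ∃[ i ] x i ≡ z
  occurs-ℕ z z≤k with a , e ← letter z z≤k with i , f ← occurs a = i , trans (cong toℕ f) e

  binary⇒k≤1 : (∀ i → x i ≤ 1) → k ≤ 1
  binary⇒k≤1 x≤1 with i , e ← occurs-ℕ k ≤-refl = subst (_≤ 1) e (x≤1 i)

  sturmian⇒NFOp₁ : Sturmian w → NFOp₁ w
  sturmian⇒NFOp₁ (x≤1 , aperiodic , balanced) = nice⇒NFOp₁
    (AperiodicBalanced.nice x x≤1 (λ p → aperiodic (periodic⇒ultimately p))
      (balanced⇒wt x≤1 (letter 1 1≤k) balanced))

  NFOp₁⇒sturmian : NFOp₁ w → Sturmian w
  NFOp₁⇒sturmian p =
    x≤1 , (λ u → aperiodic (ultimately⇒periodic u)) , wt⇒balanced x≤1 (binary⇒k≤1 x≤1) wt-balanced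
    where
    x≤1 : ∀ i → x i ≤ 1
    x≤1 = Ordered.binary x (suc k) (λ i → Fin.toℕ<n (w i)) (NFOp₁⇒nice p)
      λ i z z≤xi → occurs-ℕ z (≤-trans z≤xi (Fin.toℕ≤pred[n] (w i)))
    open Binary x x≤1 (NFOp₁⇒nice p) (occurs-ℕ 0 z≤n) (occurs-ℕ 1 1≤k)

  sturmian⇒NFOp₃ : Sturmian w → NFOp₃ w
  sturmian⇒NFOp₃ s@(x≤1 , _) = ≤-antisym k≤1 1≤k , λ v v′ S → narrow (sturmian⇒NFOp₁ s v v′ S)
    where
    k≤1 : k ≤ 1
    k≤1 = binary⇒k≤1 x≤1
    narrow : ∀ {v v′} → ∃[ a ] ∃[ b ] a Fin.< b × NiceStep a b v v′ →
      ∃[ a ] ∃[ b ] toℕ a ≡ 0 × toℕ b ≡ 1 × NiceStep a b v v′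
    narrow (a , b , a<b , step) = a , b , n<1⇒n≡0 (<-≤-trans a<b b≤1) ,
      ≤-antisym b≤1 (≤-trans (s≤s z≤n) a<b) , step
      where
      b≤1 : toℕ b ≤ 1
      b≤1 = ≤-trans (Fin.toℕ≤pred[n] b) k≤1

theorem3p9 : (k : ℕ) → 1 ≤ k → (w : InfWord k) → EveryLetterOccurs w →
    (Sturmian w ⇔ NFOp₁ w) × (Sturmian w ⇔ NFOp₂ w) × (Sturmian w ⇔ NFOp₃ w)
theorem3p9 k 1≤k w occurs =
    mk⇔ 1⇒N₁ N₁⇒1
  -- The other two equivalences go round the cycle from Sturmian to `NFOp₃`, `NFOp₂`, `NFOp₁` and
  -- back.
  , mk⇔ (λ s → NFOp₃⇒NFOp₂ w (1⇒N₃ s)) (λ p → N₁⇒1 (NFOp₂⇒NFOp₁ w p))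
  , mk⇔ 1⇒N₃ (λ p → N₁⇒1 (NFOp₂⇒NFOp₁ w (NFOp₃⇒NFOp₂ w p)))
  where
  1⇒N₁ : Sturmian w → NFOp₁ w
  1⇒N₁ = sturmian⇒NFOp₁ 1≤k w occurs
  1⇒N₃ : Sturmian w → NFOp₃ w
  1⇒N₃ = sturmian⇒NFOp₃ 1≤k w occurs
  N₁⇒1 : NFOp₁ w → Sturmian w
  N₁⇒1 = NFOp₁⇒sturmian 1≤k w occurs
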